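{- Let $m,n,a$ be nonnegative integers with $1\le m\le n+1$ and $n\le a$. Then $$\sum_{k=0}^{m-1}\binom{m}{k}^{ -1}\binom{a}{n-k}^{ -1}=g(m)\sum_{i=0}^{m-1}\frac{C(i)}{g(i)\,(i+2)\,(a+i-n+2)},$$ where $$g(m)=\frac{(a+m-n+1)!\,(a+4)!\,(m+1)}{2\,(a+m+3)!\,(a-n+2)!}$$ (and $g(i)$ is the same expression with $m$ replaced by $i$), and $$C(i)=(n+i+in+1)\binom{a}{n}^{ -1}+(2i+a-n+3)\binom{a}{n-i}^{ -1}.$$ -}

module Defs where

open import Data.Integer.Base using (+_)
open import Data.Nat.Base using (ℕ; suc; _+_; _*_; _∸_; _≤_; _!; NonZero; >-nonZero)
open import Data.Nat.Combinatorics using (_C_; nCk≡n!/k![n-k]!; k![n∸k]!∣n!)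
open import Data.Nat.DivMod using (m≥n⇒m/n>0)
open import Data.Nat.Divisibility using (∣⇒≤)
open import Data.Nat.Properties using (_!≢0; _!*_!≢0; m*n≢0; m∸n≤m; ≤-trans)
open import Data.Rational.Base as ℚ using (ℚ; Positive; _/_; _÷_)
open import Data.Rational.Properties using (+-0-monoid; normalize-pos; pos*pos⇒pos; pos⇒nonZero)
open import Relation.Binary.PropositionalEquality using (subst; sym)

open import Algebra.Properties.Monoid.Sum +-0-monoid public using (sum; sum-syntax)

fromℕ : ℕ → ℚ
fromℕ n = + n / 1

+suc-nonZero : ∀ m n → NonZero (m + suc n)
+suc-nonZero 0       n = _
+suc-nonZero (suc m) n = _

C-nonZero : ∀ {n k} → k ≤ n → NonZero (n C k)
C-nonZero {n} {k} k≤n =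
  subst NonZero (sym (nCk≡n!/k![n-k]! k≤n))
    (>-nonZero (m≥n⇒m/n>0 {{k !* (n ∸ k) !≢0}}
      (∣⇒≤ {{n !≢0}} (k![n∸k]!∣n! k≤n))))

binom⁻¹ : ∀ n k → .(k ≤ n) → ℚ
binom⁻¹ n k k≤n = (+ 1 / (n C k)) {{C-nonZero k≤n}}

-- Throughout, x + y ∸ n parses as (x + y) ∸ n; it is only used when n ≤ a,
-- where the truncated subtraction agrees with the integer one.

gNum gDen : (a n j : ℕ) → ℕ
gNum a n j = (a + j ∸ n + 1) ! * (a + 4) ! * (j + 1)
gDen a n j = 2 * (a + j + 3) ! * (a ∸ n + 2) !

gNum-nonZero : ∀ a n j → NonZero (gNum a n j)
gNum-nonZero a n j =
  m*n≢0 _ _ {{(a + j ∸ n + 1) !* (a + 4) !≢0}} {{+suc-nonZero j 0}}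

gDen-nonZero : ∀ a n j → NonZero (gDen a n j)
gDen-nonZero a n j =
  m*n≢0 _ _ {{m*n≢0 2 _ {{_}} {{(a + j + 3) !≢0}}}} {{(a ∸ n + 2) !≢0}}

g : (a n j : ℕ) → ℚ
g a n j = (+ gNum a n j / gDen a n j) {{gDen-nonZero a n j}}

-- The numerator C(i) of the right-hand summand; n ∸ i is the true difference
-- for the indices i < m ≤ n + 1 that occur.
Cᵢ : (a n : ℕ) → .(n ≤ a) → ℕ → ℚ
Cᵢ a n n≤a i =
  fromℕ (n + i + i * n + 1) ℚ.* binom⁻¹ a n n≤a
  ℚ.+ fromℕ (2 * i + a ∸ n + 3) ℚ.* binom⁻¹ a (n ∸ i) (≤-trans (m∸n≤m n i) n≤a)

summandDen : (a n i : ℕ) → ℚ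
summandDen a n i = g a n i ℚ.* fromℕ (i + 2) ℚ.* fromℕ (a + i ∸ n + 2)

summandDen-nonZero : ∀ a n i → ℚ.NonZero (summandDen a n i)
summandDen-nonZero a n i = pos⇒nonZero (summandDen a n i) {{den-pos}}
  where
  fromℕ-pos : ∀ x y → Positive (fromℕ (x + suc y))
  fromℕ-pos x y = normalize-pos _ 1 {{_}} {{+suc-nonZero x y}}

  g-pos : Positive (g a n i)
  g-pos = normalize-pos _ _ {{gDen-nonZero a n i}} {{gNum-nonZero a n i}}

  den-pos : Positive (summandDen a n i)
  den-pos =
    pos*pos⇒pos (g a n i ℚ.* fromℕ (i + 2))
      {{pos*pos⇒pos (g a n i) {{g-pos}} (fromℕ (i + 2)) {{fromℕ-pos i 1}}}}
      (fromℕ (a + i ∸ n + 2)) {{fromℕ-pos (a + i ∸ n) 1}}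

summand : (a n : ℕ) → .(n ≤ a) → ℕ → ℚ
summand a n n≤a i = (Cᵢ a n n≤a i ÷ summandDen a n i) {{summandDen-nonZero a n i}}

{-# OPTIONS --safe #-}
module Submission where

-- Creative telescoping. Write F(m,k) for the summand on the left and S(m) for
-- the left-hand side. With T(m,k) = (m+1−k)(n+1−k) F(m,k) one has
--   (m+1)(a+m+4) F(m+1,k) − (m+2)(a+m−n+2) F(m,k) = T(m,k) − T(m,k+1),
-- and summing over k < m gives the first-order recurrence
--   (m+1)(a+m+4) S(m+1) = (m+2)(a+m−n+2) S(m) + C(m).
-- The factor g solves its homogeneous part, so dividing by g turns the
-- recurrence into a sum.

open import Defs
open import Data.Nat.Base using (ℕ; _+_; _∸_; _≤_)
open import Data.Nat.Properties using (≤-trans; m∸n≤m)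
open import Data.Fin.Base using (toℕ)
open import Data.Fin.Properties using (toℕ≤n)
open import Data.Rational.Base using (_*_)
open import Relation.Binary.PropositionalEquality using (_≡_)

open import Data.Fin.Properties using (toℕ-fromℕ; toℕ-inject₁)
open import Data.Integer.Base as ℤ using (+_)
import Data.Integer.Properties as ℤ
open import Data.Nat.Base as ℕ using (zero; suc; _<_; s≤s; _!; NonZero)
open import Data.Nat.Combinatorics using (_C_; nCk≡n!/k![n-k]!; k![n∸k]!∣n!; [n-k]*[n-k-1]!≡[n-k]!)
open import Data.Nat.DivMod using (m/n*n≡m)
import Data.Nat.Properties as ℕ
open import Data.Nat.Properties using (_!≢0; _!*_!≢0)
open import Data.Nat.Tactic.RingSolver using (solve-∀)
open import Data.Product.Base using (_,_)
open import Data.Rational.Base as ℚ using (ℚ; 1ℚ; _/_; 1/_; fromℚᵘ)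
import Data.Rational.Properties as ℚ
open import Data.Rational.Solver using (module +-*-Solver)
open import Data.Rational.Unnormalised.Base as ℚᵘ using (mkℚᵘ; *≡*)
import Data.Rational.Unnormalised.Properties as ℚᵘ
open import Relation.Binary.PropositionalEquality using (refl; sym; trans; cong; cong₂; module ≡-Reasoning)
open import Algebra.Properties.Monoid.Sum ℚ.+-0-monoid using (sum-cong-≗; sum-init-last)

open ≡-Reasoning

-- Rational arithmetic: natural-number scalars, cancellation, finite sums.

fromℚᵘ-homo-+ : ∀ p q → fromℚᵘ (p ℚᵘ.+ q) ≡ fromℚᵘ p ℚ.+ fromℚᵘ q
fromℚᵘ-homo-+ p q = ℚ.toℚᵘ-injective
  (ℚᵘ.≃-trans (ℚ.toℚᵘ-fromℚᵘ (p ℚᵘ.+ q))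
  (ℚᵘ.≃-sym (ℚᵘ.≃-trans (ℚ.toℚᵘ-homo-+ (fromℚᵘ p) (fromℚᵘ q))
    (ℚᵘ.+-cong (ℚ.toℚᵘ-fromℚᵘ p) (ℚ.toℚᵘ-fromℚᵘ q)))))

fromℚᵘ-homo-* : ∀ p q → fromℚᵘ (p ℚᵘ.* q) ≡ fromℚᵘ p * fromℚᵘ q
fromℚᵘ-homo-* p q = ℚ.toℚᵘ-injective
  (ℚᵘ.≃-trans (ℚ.toℚᵘ-fromℚᵘ (p ℚᵘ.* q))
  (ℚᵘ.≃-sym (ℚᵘ.≃-trans (ℚ.toℚᵘ-homo-* (fromℚᵘ p) (fromℚᵘ q))
    (ℚᵘ.*-cong (ℚ.toℚᵘ-fromℚᵘ p) (ℚ.toℚᵘ-fromℚᵘ q)))))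

/-cross : ∀ p q r s .{{_ : NonZero q}} .{{_ : NonZero s}} →
          p ℕ.* s ≡ r ℕ.* q → + p / q ≡ + r / s
-- With successor denominators, `_/_` unfolds to `fromℚᵘ` of an unnormalised fraction, where
-- equality is cross multiplication.
/-cross p (suc q) r (suc s) eq = ℚ.fromℚᵘ-cong {mkℚᵘ (+ p) q} {mkℚᵘ (+ r) s} (*≡* (begin
  + p ℤ.* + suc s    ≡⟨ ℤ.pos-* p (suc s) ⟨
  + (p ℕ.* suc s)   ≡⟨ cong +_ eq ⟩
  + (r ℕ.* suc q)   ≡⟨ ℤ.pos-* r (suc q) ⟩
  + r ℤ.* + suc q    ∎))

fromℕ-*-/ : ∀ x p q .{{_ : NonZero q}} → fromℕ x * (+ p / q) ≡ + (x ℕ.* p) / q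
fromℕ-*-/ x p (suc q) = begin
  fromℕ x * (+ p / suc q)                    ≡⟨ fromℚᵘ-homo-* (mkℚᵘ (+ x) 0) (mkℚᵘ (+ p) q) ⟨
  fromℚᵘ (mkℚᵘ (+ x) 0 ℚᵘ.* mkℚᵘ (+ p) q)    ≡⟨ ℚ./-cong (sym (ℤ.pos-* x p)) (ℕ.*-identityˡ (suc q)) ⟩
  + (x ℕ.* p) / suc q                        ∎

-- Reduces a contiguity relation between two quotients to an identity in ℕ free of division. The
-- relations for `β` and for `g` all come from it.
scale-/ : ∀ x p q y r s .{{_ : NonZero q}} .{{_ : NonZero s}} →
          (x ℕ.* p) ℕ.* s ≡ (y ℕ.* r) ℕ.* q → fromℕ x * (+ p / q) ≡ fromℕ y * (+ r / s)
scale-/ x p q y r s eq = begin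
  fromℕ x * (+ p / q)   ≡⟨ fromℕ-*-/ x p q ⟩
  + (x ℕ.* p) / q       ≡⟨ /-cross (x ℕ.* p) q (y ℕ.* r) s eq ⟩
  + (y ℕ.* r) / s       ≡⟨ fromℕ-*-/ y r s ⟨
  fromℕ y * (+ r / s)   ∎

fromℕ-homo-* : ∀ x y → fromℕ (x ℕ.* y) ≡ fromℕ x * fromℕ y
fromℕ-homo-* x y = sym (fromℕ-*-/ x y 1)

fromℕ-homo-+ : ∀ x y → fromℕ (x + y) ≡ fromℕ x ℚ.+ fromℕ y
fromℕ-homo-+ x y = begin
  fromℕ (x + y)                              ≡⟨ ℚ./-cong (cong₂ ℤ._+_ (sym (ℤ.*-identityʳ (+ x))) (sym (ℤ.*-identityʳ (+ y)))) refl ⟩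
  fromℚᵘ (mkℚᵘ (+ x) 0 ℚᵘ.+ mkℚᵘ (+ y) 0)    ≡⟨ fromℚᵘ-homo-+ (mkℚᵘ (+ x) 0) (mkℚᵘ (+ y) 0) ⟩
  fromℕ x ℚ.+ fromℕ y                        ∎

*-cancelˡ-nonZero : ∀ r p q .{{_ : ℚ.NonZero r}} → r * p ≡ r * q → p ≡ q
*-cancelˡ-nonZero r p q eq = begin
  p                 ≡⟨ undo p ⟨
  (1/ r) * (r * p)  ≡⟨ cong ((1/ r) *_) eq ⟩
  (1/ r) * (r * q)  ≡⟨ undo q ⟩
  q                 ∎
  where
  undo : ∀ x → (1/ r) * (r * x) ≡ x
  undo x = begin
    (1/ r) * (r * x)  ≡⟨ ℚ.*-assoc (1/ r) r x ⟨
    (1/ r) * r * x    ≡⟨ cong (_* x) (ℚ.*-inverseˡ r) ⟩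
    1ℚ * x            ≡⟨ ℚ.*-identityˡ x ⟩
    x                 ∎

÷-cancel : ∀ p q .{{_ : ℚ.NonZero q}} → q * (p ℚ.÷ q) ≡ p
÷-cancel p q = begin
  q * (p * 1/ q)  ≡⟨ cong (q *_) (ℚ.*-comm p (1/ q)) ⟩
  q * (1/ q * p)  ≡⟨ ℚ.*-assoc q (1/ q) p ⟨
  q * 1/ q * p    ≡⟨ cong (_* p) (ℚ.*-inverseʳ q) ⟩
  1ℚ * p          ≡⟨ ℚ.*-identityˡ p ⟩
  p               ∎

∑-last : ∀ (f : ℕ → ℚ) m → ∑[ k < suc m ] f (toℕ k) ≡ (∑[ k < m ] f (toℕ k)) ℚ.+ f m
∑-last f m = trans (sum-init-last {m} (λ k → f (toℕ k)))
  (cong₂ ℚ._+_ (sum-cong-≗ {m} (λ k → cong f (toℕ-inject₁ k))) (cong f (toℕ-fromℕ m)))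

-- Inverse binomial coefficients and their contiguity relations.

-- Inverse binomial coefficient, total in k unlike binom⁻¹; junk value for k > n.
β : ℕ → ℕ → ℚ
β n k = (+ (k ! ℕ.* (n ∸ k) !) / n !) {{n !≢0}}

binom⁻¹≡β : ∀ n k (k≤n : k ≤ n) → binom⁻¹ n k k≤n ≡ β n k
binom⁻¹≡β n k k≤n = /-cross 1 (n C k) (k ! ℕ.* (n ∸ k) !) (n !) {{C-nonZero k≤n}} {{n !≢0}} (begin
  1 ℕ.* n !                       ≡⟨ ℕ.*-identityˡ (n !) ⟩
  n !                             ≡⟨ m/n*n≡m (k![n∸k]!∣n! k≤n) ⟨
  (n ! ℕ./ d) ℕ.* d               ≡⟨ cong (ℕ._* d) (nCk≡n!/k![n-k]! k≤n) ⟨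
  (n C k) ℕ.* d                   ≡⟨ ℕ.*-comm (n C k) d ⟩
  d ℕ.* (n C k)                   ∎)
  where
  d = k ! ℕ.* (n ∸ k) !
  instance _ = k !* (n ∸ k) !≢0

β-sucʳ : ∀ {n k} → k < n → fromℕ (n ∸ k) * β n (suc k) ≡ fromℕ (suc k) * β n k
β-sucʳ {n} {k} k<n = scale-/
  (n ∸ k) (suc k ! ℕ.* (n ∸ suc k) !) (n !) (suc k) (k ! ℕ.* (n ∸ k) !) (n !) {{n !≢0}} {{n !≢0}} (cong (ℕ._* n !) (begin
  (n ∸ k) ℕ.* ((suc k) ! ℕ.* (n ∸ suc k) !)  ≡⟨ rearrange (n ∸ k) (suc k) (k !) ((n ∸ suc k) !) ⟩
  suc k ℕ.* (k ! ℕ.* ((n ∸ k) ℕ.* (n ∸ suc k) !))  ≡⟨ cong (λ z → suc k ℕ.* (k ! ℕ.* z)) ([n-k]*[n-k-1]!≡[n-k]! k<n) ⟩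
  suc k ℕ.* (k ! ℕ.* (n ∸ k) !)              ∎))
  where
  rearrange : ∀ x y u v → x ℕ.* ((y ℕ.* u) ℕ.* v) ≡ y ℕ.* (u ℕ.* (x ℕ.* v))
  rearrange = solve-∀

β-sucˡ : ∀ {n k} → k ≤ n → fromℕ (suc n) * β (suc n) k ≡ fromℕ (suc n ∸ k) * β n k
β-sucˡ {n} {k} k≤n = scale-/
  (suc n) (k ! ℕ.* (suc n ∸ k) !) (suc n !) (suc n ∸ k) (k ! ℕ.* (n ∸ k) !) (n !) {{suc n !≢0}} {{n !≢0}} (begin
  suc n ℕ.* (k ! ℕ.* (suc n ∸ k) !) ℕ.* n !
    ≡⟨ cong (λ z → suc n ℕ.* (k ! ℕ.* z) ℕ.* n !) ([n-k]*[n-k-1]!≡[n-k]! (s≤s k≤n)) ⟨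
  suc n ℕ.* (k ! ℕ.* ((suc n ∸ k) ℕ.* (n ∸ k) !)) ℕ.* n !
    ≡⟨ rearrange (suc n) (k !) (suc n ∸ k) ((n ∸ k) !) (n !) ⟩
  (suc n ∸ k) ℕ.* (k ! ℕ.* (n ∸ k) !) ℕ.* (suc n) !  ∎)
  where
  rearrange : ∀ x u y v w → x ℕ.* (u ℕ.* (y ℕ.* v)) ℕ.* w ≡ y ℕ.* (u ℕ.* v) ℕ.* (x ℕ.* w)
  rearrange = solve-∀

β-zero : ∀ n → β n 0 ≡ 1ℚ
β-zero n = /-cross (1 ℕ.* n !) (n !) 1 1 {{n !≢0}} (ℕ.*-identityʳ (1 ℕ.* n !))

β-self : ∀ n → β n n ≡ 1ℚ
β-self n = /-cross (n ! ℕ.* (n ∸ n) !) (n !) 1 1 {{n !≢0}} (begin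
  n ! ℕ.* (n ∸ n) ! ℕ.* 1  ≡⟨ cong (λ z → n ! ℕ.* z ! ℕ.* 1) (ℕ.n∸n≡0 n) ⟩
  n ! ℕ.* 1 ℕ.* 1          ≡⟨ rearrange (n !) ⟩
  1 ℕ.* n !                ∎)
  where
  rearrange : ∀ x → x ℕ.* 1 ℕ.* 1 ≡ 1 ℕ.* x
  rearrange = solve-∀

-- This is `β-sucʳ` read backwards at the index `j = n ∸ suc k`, whose complement in `a` is
-- `suc k + (a ∸ n)`.
β-pred : ∀ {a n k} → k < n → n ≤ a →
         fromℕ (n ∸ k) * β a (n ∸ suc k) ≡ fromℕ (suc k + (a ∸ n)) * β a (n ∸ k)
β-pred {a} {n} {k} k<n n≤a = begin
  fromℕ (n ∸ k) * β a j         ≡⟨ cong (λ z → fromℕ z * β a j) n∸k≡1+j ⟩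
  fromℕ (suc j) * β a j         ≡⟨ β-sucʳ j<a ⟨
  fromℕ (a ∸ j) * β a (suc j)   ≡⟨ cong₂ (λ y z → fromℕ y * β a z) a∸j n∸k≡1+j ⟨
  fromℕ (suc k + (a ∸ n)) * β a (n ∸ k) ∎
  where
  j = n ∸ suc k
  n∸k≡1+j : n ∸ k ≡ suc j
  n∸k≡1+j = ℕ.+-∸-assoc 1 k<n
  j<a : j < a
  j<a = ≤-trans (ℕ.≤-reflexive (sym n∸k≡1+j)) (≤-trans (m∸n≤m n k) n≤a)
  a∸j : suc k + (a ∸ n) ≡ a ∸ j
  a∸j = begin
    suc k + (a ∸ n)              ≡⟨ ℕ.m+n∸m≡n j (suc k + (a ∸ n)) ⟨
    j + (suc k + (a ∸ n)) ∸ j    ≡⟨ cong (_∸ j) (ℕ.+-assoc j (suc k) (a ∸ n)) ⟨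
    j + suc k + (a ∸ n) ∸ j      ≡⟨ cong (λ z → z + (a ∸ n) ∸ j) (ℕ.m∸n+n≡m k<n) ⟩
    n + (a ∸ n) ∸ j              ≡⟨ cong (_∸ j) (ℕ.m+[n∸m]≡n n≤a) ⟩
    a ∸ j                        ∎

-- Multiplies two contiguity relations, one for each inverse binomial in the summand.
*-scale₂ : ∀ x x′ y y′ {b b′ c c′} →
           fromℕ x * b ≡ fromℕ x′ * b′ → fromℕ y * c ≡ fromℕ y′ * c′ →
           fromℕ (x ℕ.* y) * (b * c) ≡ fromℕ (x′ ℕ.* y′) * (b′ * c′)
*-scale₂ x x′ y y′ {b} {b′} {c} {c′} eq₁ eq₂ = begin
  fromℕ (x ℕ.* y) * (b * c)            ≡⟨ split x y b c ⟩
  (fromℕ x * b) * (fromℕ y * c)        ≡⟨ cong₂ _*_ eq₁ eq₂ ⟩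
  (fromℕ x′ * b′) * (fromℕ y′ * c′)    ≡⟨ split x′ y′ b′ c′ ⟨
  fromℕ (x′ ℕ.* y′) * (b′ * c′)        ∎
  where
  interchange : ∀ p q r s → (p * q) * (r * s) ≡ (p * r) * (q * s)
  interchange = solve 4 (λ p q r s → (p :* q) :* (r :* s) := (p :* r) :* (q :* s)) refl
    where open +-*-Solver
  split : ∀ x y b c → fromℕ (x ℕ.* y) * (b * c) ≡ (fromℕ x * b) * (fromℕ y * c)
  split x y b c = trans (cong (_* (b * c)) (fromℕ-homo-* x y)) (interchange (fromℕ x) (fromℕ y) b c)

fromℕ-distribʳ : ∀ x y p → fromℕ (x + y) * p ≡ fromℕ x * p ℚ.+ fromℕ y * p
fromℕ-distribʳ x y p = trans (cong (_* p) (fromℕ-homo-+ x y)) (ℚ.*-distribʳ-+ p (fromℕ x) (fromℕ y))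

-- The summand and its telescoping certificate.

F : (a n m k : ℕ) → ℚ
F a n m k = β m k * β a (n ∸ k)

S : (a n m : ℕ) → ℚ
S a n m = ∑[ k < m ] F a n m (toℕ k)

P : (a m : ℕ) → ℕ
P a m = suc m ℕ.* (a + m + 4)

Q : (a n m : ℕ) → ℕ
Q a n m = (m + 2) ℕ.* (a + m ∸ n + 2)

-- Up to sign, the Wilf–Zeilberger certificate of the recurrence for S.
T : (a n m k : ℕ) → ℚ
T a n m k = fromℕ ((suc m ∸ k) ℕ.* (suc n ∸ k)) * F a n m k

-- The factor `suc m` of `P a m` is absorbed by `β-sucˡ`; the factor `a + m + 4` is only carried
-- along, since `β a (n ∸ k)` does not depend on `m`.
P-F-suc : ∀ {a n m k} → k ≤ m →
          fromℕ (P a m) * F a n (suc m) k ≡ fromℕ ((suc m ∸ k) ℕ.* (a + m + 4)) * F a n m k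
P-F-suc {a} {n} {m} {k} k≤m =
  *-scale₂ (suc m) (suc m ∸ k) (a + m + 4) (a + m + 4) {c = β a (n ∸ k)} (β-sucˡ k≤m) refl

-- At `suc k` the weight in `T` reduces to `(m ∸ k) ℕ.* (n ∸ k)`, and each factor moves one inverse
-- binomial back from `suc k` to `k`.
T-suc : ∀ {a n m k} → k < m → m ≤ n → n ≤ a →
        T a n m (suc k) ≡ fromℕ (suc k ℕ.* (suc k + (a ∸ n))) * F a n m k
T-suc {a} {n} {m} {k} k<m m≤n n≤a = *-scale₂ (m ∸ k) (suc k) (n ∸ k) (suc k + (a ∸ n))
  (β-sucʳ k<m) (β-pred (≤-trans k<m m≤n) n≤a)

n+w+m∸n≡w+m : ∀ n w m → n + w + m ∸ n ≡ w + m
n+w+m∸n≡w+m n w m = trans (cong (_∸ n) (ℕ.+-assoc n w m)) (ℕ.m+n∸m≡n n (w + m))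

-- What remains of the certificate identity once `F a n m k` is factored out, with negative terms
-- moved across so that it lives in ℕ.
certificate-coefficients : ∀ {a n m k} → k ≤ m → m ≤ n → n ≤ a →
  (suc m ∸ k) ℕ.* (a + m + 4) + suc k ℕ.* (suc k + (a ∸ n))
    ≡ Q a n m + (suc m ∸ k) ℕ.* (suc n ∸ k)
certificate-coefficients {k = k} k≤m m≤n n≤a
  -- Writing `m = k + u`, `n = m + v`, `a = n + w` turns every truncated difference into a sum,
  -- leaving a polynomial identity.
  with u , refl ← ℕ.m≤n⇒∃[o]m+o≡n k≤m
  with v , refl ← ℕ.m≤n⇒∃[o]m+o≡n m≤n
  with w , refl ← ℕ.m≤n⇒∃[o]m+o≡n n≤a
  rewrite ℕ.+-∸-assoc 1 k≤m
        | ℕ.+-∸-assoc 1 (≤-trans k≤m m≤n)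
        | n+w+m∸n≡w+m (k + u + v) w (k + u)
        | ℕ.m+n∸m≡n (k + u + v) w
        | ℕ.+-assoc k u v
        | ℕ.m+n∸m≡n k u
        | ℕ.m+n∸m≡n k (u + v)
  = identity k u v w
  where
  identity : ∀ k u v w →
    suc u ℕ.* (k + (u + v) + w + (k + u) + 4) + suc k ℕ.* (suc k + w)
      ≡ (k + u + 2) ℕ.* (w + (k + u) + 2) + suc u ℕ.* suc (u + v)
  identity = solve-∀

-- Strictness of `k < m` keeps `suc k` within row `m`. The index `k = m` of the next sum is left to
-- `P-F-last`.
certificate-step : ∀ {a n m k} → k < m → m ≤ n → n ≤ a →
  fromℕ (P a m) * F a n (suc m) k ℚ.+ T a n m (suc k)
    ≡ fromℕ (Q a n m) * F a n m k ℚ.+ T a n m k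
certificate-step {a} {n} {m} {k} k<m m≤n n≤a = begin
  fromℕ (P a m) * F a n (suc m) k ℚ.+ T a n m (suc k)
    ≡⟨ cong₂ ℚ._+_ (P-F-suc (ℕ.<⇒≤ k<m)) (T-suc k<m m≤n n≤a) ⟩
  fromℕ x * f ℚ.+ fromℕ y * f
    ≡⟨ fromℕ-distribʳ x y f ⟨
  fromℕ (x + y) * f
    ≡⟨ cong (λ z → fromℕ z * f) (certificate-coefficients (ℕ.<⇒≤ k<m) m≤n n≤a) ⟩
  fromℕ (Q a n m + (suc m ∸ k) ℕ.* (suc n ∸ k)) * f
    ≡⟨ fromℕ-distribʳ (Q a n m) _ f ⟩
  fromℕ (Q a n m) * f ℚ.+ T a n m k
    ∎
  where
  f = F a n m k
  x = (suc m ∸ k) ℕ.* (a + m + 4)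
  y = suc k ℕ.* (suc k + (a ∸ n))

-- Summation, boundary terms and the recurrence.

telescope : ∀ (p q : ℚ) (u v t : ℕ → ℚ) j →
  (∀ {k} → k < j → p * u k ℚ.+ t (suc k) ≡ q * v k ℚ.+ t k) →
  p * (∑[ k < j ] u (toℕ k)) ℚ.+ t j ≡ q * (∑[ k < j ] v (toℕ k)) ℚ.+ t 0
telescope p q u v t zero    step = cong (ℚ._+ t 0) (trans (ℚ.*-zeroʳ p) (sym (ℚ.*-zeroʳ q)))
telescope p q u v t (suc j) step = begin
  p * (∑[ k < suc j ] u (toℕ k)) ℚ.+ t (suc j)   ≡⟨ cong (λ z → p * z ℚ.+ t (suc j)) (∑-last u j) ⟩
  p * (U ℚ.+ u j) ℚ.+ t (suc j)                  ≡⟨ regroup₁ p U (u j) (t (suc j)) ⟩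
  p * U ℚ.+ (p * u j ℚ.+ t (suc j))              ≡⟨ cong (p * U ℚ.+_) (step ℕ.≤-refl) ⟩
  p * U ℚ.+ (q * v j ℚ.+ t j)                    ≡⟨ regroup₂ (p * U) (q * v j) (t j) ⟩
  p * U ℚ.+ t j ℚ.+ q * v j                      ≡⟨ cong (ℚ._+ q * v j) (telescope p q u v t j (λ k<j → step (ℕ.m≤n⇒m≤1+n k<j))) ⟩
  q * V ℚ.+ t 0 ℚ.+ q * v j                      ≡⟨ regroup₃ q V (t 0) (v j) ⟩
  q * (V ℚ.+ v j) ℚ.+ t 0                        ≡⟨ cong (λ z → q * z ℚ.+ t 0) (∑-last v j) ⟨
  q * (∑[ k < suc j ] v (toℕ k)) ℚ.+ t 0         ∎
  where
  open +-*-Solver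
  U V : ℚ
  U = ∑[ k < j ] u (toℕ k)
  V = ∑[ k < j ] v (toℕ k)
  regroup₁ : ∀ p x y z → p * (x ℚ.+ y) ℚ.+ z ≡ p * x ℚ.+ (p * y ℚ.+ z)
  regroup₁ = solve 4 (λ p x y z → p :* (x :+ y) :+ z := p :* x :+ (p :* y :+ z)) refl
  regroup₂ : ∀ x y z → x ℚ.+ (y ℚ.+ z) ≡ x ℚ.+ z ℚ.+ y
  regroup₂ = solve 3 (λ x y z → x :+ (y :+ z) := x :+ z :+ y) refl
  regroup₃ : ∀ q x y z → q * x ℚ.+ y ℚ.+ q * z ≡ q * (x ℚ.+ z) ℚ.+ y
  regroup₃ = solve 4 (λ q x y z → q :* x :+ y :+ q :* z := q :* (x :+ z) :+ y) refl

-- The lower boundary term is the first half of C(m).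
T-zero : ∀ a n m → T a n m 0 ≡ fromℕ (n + m + m ℕ.* n + 1) * β a n
T-zero a n m = cong₂ _*_ (cong fromℕ (identity m n))
  (trans (cong (_* β a n) (β-zero m)) (ℚ.*-identityˡ (β a n)))
  where
  identity : ∀ m n → suc m ℕ.* suc n ≡ n + m + m ℕ.* n + 1
  identity = solve-∀

-- Although `suc m ∸ m` is 1, it stays unreduced so that both products match the coefficients in
-- `P-F-suc` and `T a n m m`.
last-coefficients : ∀ {a n m} → m ≤ n → n ≤ a →
  (suc m ∸ m) ℕ.* (a + m + 4) ≡ (suc m ∸ m) ℕ.* (suc n ∸ m) + (2 ℕ.* m + a ∸ n + 3)
last-coefficients {m = m} m≤n n≤a
  with v , refl ← ℕ.m≤n⇒∃[o]m+o≡n m≤n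
  with w , refl ← ℕ.m≤n⇒∃[o]m+o≡n n≤a
  rewrite ℕ.m+n∸n≡m 1 m
        | ℕ.+-∸-assoc 1 m≤n
        | ℕ.m+n∸m≡n m v
        -- Moves `n = m + v` to the front of the sum, where it cancels.
        | ℕ.+-comm (2 ℕ.* m) (m + v + w)
        | n+w+m∸n≡w+m (m + v) w (2 ℕ.* m)
  = identity m v w
  where
  identity : ∀ m v w → 1 ℕ.* (m + v + w + m + 4) ≡ 1 ℕ.* suc v + (w + 2 ℕ.* m + 3)
  identity = solve-∀

-- The term `k = m` has no counterpart in `S a n m`. It splits into the upper boundary term needed
-- for telescoping and the second half of C(m).
P-F-last : ∀ {a n m} → m ≤ n → n ≤ a →
  fromℕ (P a m) * F a n (suc m) m ≡ T a n m m ℚ.+ fromℕ (2 ℕ.* m + a ∸ n + 3) * β a (n ∸ m)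
P-F-last {a} {n} {m} m≤n n≤a = begin
  fromℕ (P a m) * F a n (suc m) m
    ≡⟨ P-F-suc {a} {n} (ℕ.≤-refl {m}) ⟩
  fromℕ ((suc m ∸ m) ℕ.* (a + m + 4)) * F a n m m
    ≡⟨ cong (λ z → fromℕ z * F a n m m) (last-coefficients m≤n n≤a) ⟩
  fromℕ ((suc m ∸ m) ℕ.* (suc n ∸ m) + c) * F a n m m
    ≡⟨ fromℕ-distribʳ ((suc m ∸ m) ℕ.* (suc n ∸ m)) c (F a n m m) ⟩
  T a n m m ℚ.+ fromℕ c * F a n m m
    ≡⟨ cong (λ z → T a n m m ℚ.+ fromℕ c * z) (trans (cong (_* β a (n ∸ m)) (β-self m)) (ℚ.*-identityˡ _)) ⟩
  T a n m m ℚ.+ fromℕ c * β a (n ∸ m)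
    ∎
  where c = 2 ℕ.* m + a ∸ n + 3

Cᵢ≡β : ∀ a n m (n≤a : n ≤ a) →
  Cᵢ a n n≤a m ≡ fromℕ (n + m + m ℕ.* n + 1) * β a n ℚ.+ fromℕ (2 ℕ.* m + a ∸ n + 3) * β a (n ∸ m)
Cᵢ≡β a n m n≤a = cong₂ (λ y z → fromℕ (n + m + m ℕ.* n + 1) * y ℚ.+ fromℕ (2 ℕ.* m + a ∸ n + 3) * z)
  (binom⁻¹≡β a n n≤a) (binom⁻¹≡β a (n ∸ m) (≤-trans (m∸n≤m n m) n≤a))

S-recurrence : ∀ {a n m} → m ≤ n → (n≤a : n ≤ a) →
  fromℕ (P a m) * S a n (suc m) ≡ fromℕ (Q a n m) * S a n m ℚ.+ Cᵢ a n n≤a m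
S-recurrence {a} {n} {m} m≤n n≤a = begin
  p * S a n (suc m)                        ≡⟨ cong (p *_) (∑-last (F a n (suc m)) m) ⟩
  p * (S′ ℚ.+ F a n (suc m) m)             ≡⟨ ℚ.*-distribˡ-+ p S′ _ ⟩
  p * S′ ℚ.+ p * F a n (suc m) m           ≡⟨ cong (p * S′ ℚ.+_) (P-F-last m≤n n≤a) ⟩
  p * S′ ℚ.+ (T a n m m ℚ.+ c)             ≡⟨ ℚ.+-assoc (p * S′) (T a n m m) c ⟨
  p * S′ ℚ.+ T a n m m ℚ.+ c
    -- The `T a n m m` split off from the last term closes the telescoping sum and leaves only
    -- `T a n m 0`.
    ≡⟨ cong (ℚ._+ c) (telescope p q (F a n (suc m)) (F a n m) (T a n m) m (λ k<m → certificate-step k<m m≤n n≤a)) ⟩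
  q * S a n m ℚ.+ T a n m 0 ℚ.+ c          ≡⟨ cong (λ z → q * S a n m ℚ.+ z ℚ.+ c) (T-zero a n m) ⟩
  q * S a n m ℚ.+ b ℚ.+ c                  ≡⟨ ℚ.+-assoc (q * S a n m) b c ⟩
  q * S a n m ℚ.+ (b ℚ.+ c)                ≡⟨ cong (q * S a n m ℚ.+_) (Cᵢ≡β a n m n≤a) ⟨
  q * S a n m ℚ.+ Cᵢ a n n≤a m             ∎
  where
  p q b c S′ : ℚ
  p = fromℕ (P a m)
  q = fromℕ (Q a n m)
  b = fromℕ (n + m + m ℕ.* n + 1) * β a n
  c = fromℕ (2 ℕ.* m + a ∸ n + 3) * β a (n ∸ m)
  S′ = ∑[ k < m ] F a n (suc m) (toℕ k)

-- Solving the recurrence.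

g-suc : ∀ {a n} m → n ≤ a → fromℕ (P a m) * g a n (suc m) ≡ fromℕ (Q a n m) * g a n m
g-suc {a} {n} m n≤a = scale-/ (P a m) (gNum a n (suc m)) (gDen a n (suc m)) (Q a n m) (gNum a n m) (gDen a n m)
  {{gDen-nonZero a n (suc m)}} {{gDen-nonZero a n m}} nat
  where
  x = a + m ∸ n
  a+[1+m]∸n : a + suc m ∸ n ≡ suc x
  a+[1+m]∸n = trans (cong (_∸ n) (ℕ.+-suc a m)) (ℕ.+-∸-assoc 1 (≤-trans n≤a (ℕ.m≤m+n a m)))
  -- Here `s` is `a + m`, and `X`, `A`, `D`, `E` stand for the factorials common to both sides;
  -- passing to `suc m` unfolds one factor of `X` and one of `D`.
  identity : ∀ m s x X A D E →
    suc m ℕ.* (s + 4) ℕ.* (suc (x + 1) ℕ.* X ℕ.* A ℕ.* (suc m + 1)) ℕ.* (2 ℕ.* D ℕ.* E)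
      ≡ (m + 2) ℕ.* (x + 2) ℕ.* (X ℕ.* A ℕ.* (m + 1)) ℕ.* (2 ℕ.* (suc (s + 3) ℕ.* D) ℕ.* E)
  identity = solve-∀
  nat : P a m ℕ.* gNum a n (suc m) ℕ.* gDen a n m ≡ Q a n m ℕ.* gNum a n m ℕ.* gDen a n (suc m)
  nat rewrite a+[1+m]∸n | ℕ.+-suc a m =
    identity m (a + m) x ((x + 1) !) ((a + 4) !) ((a + m + 3) !) ((a ∸ n + 2) !)

-- `Q a n m` is the product of the two linear factors in `summandDen`, so the summand is the
-- inhomogeneous term C(m) divided by `Q` times `g`.
summand-spec : ∀ a n (n≤a : n ≤ a) m →
  fromℕ (Q a n m) * g a n m * summand a n n≤a m ≡ Cᵢ a n n≤a m
summand-spec a n n≤a m = begin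
  fromℕ (Q a n m) * g a n m * s     ≡⟨ cong (λ z → z * g a n m * s) (fromℕ-homo-* (m + 2) (a + m ∸ n + 2)) ⟩
  y * z * g a n m * s               ≡⟨ cong (_* s) (rearrange y z (g a n m)) ⟩
  summandDen a n m * s              ≡⟨ ÷-cancel (Cᵢ a n n≤a m) (summandDen a n m) {{summandDen-nonZero a n m}} ⟩
  Cᵢ a n n≤a m                      ∎
  where
  s y z : ℚ
  s = summand a n n≤a m
  y = fromℕ (m + 2)
  z = fromℕ (a + m ∸ n + 2)
  rearrange : ∀ y z w → y * z * w ≡ w * y * z
  rearrange = solve 3 (λ y z w → y :* z :* w := w :* y :* z) refl
    where open +-*-Solver

fromℕ-nonZero : ∀ x .{{_ : NonZero x}} → ℚ.NonZero (fromℕ x)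
fromℕ-nonZero x = ℚ.pos⇒nonZero (fromℕ x) {{ℚ.normalize-pos x 1}}

-- Variation of constants, by induction on `m` from the empty sums: `g` carries the homogeneous
-- part, and each step adds one summand to the cofactor.
S-closed : ∀ {a n} m → m ≤ n + 1 → (n≤a : n ≤ a) →
  S a n m ≡ g a n m * (∑[ i < m ] summand a n n≤a (toℕ i))
S-closed {a} {n} zero    _      n≤a = sym (ℚ.*-zeroʳ (g a n 0))
-- The recurrence fixes `S a n (suc m)` only up to the factor `P a m`, which is nonzero and is
-- cancelled.
S-closed {a} {n} (suc m) m<n+1 n≤a = *-cancelˡ-nonZero p _ _ {{fromℕ-nonZero (P a m) {{P-nonZero}}}} (begin
  p * S a n (suc m)                          ≡⟨ S-recurrence m≤n n≤a ⟩
  q * S a n m ℚ.+ Cᵢ a n n≤a m               ≡⟨ cong₂ (λ y z → q * y ℚ.+ z) (S-closed m (ℕ.<⇒≤ m<n+1) n≤a) (sym (summand-spec a n n≤a m)) ⟩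
  q * (g a n m * R) ℚ.+ q * g a n m * s      ≡⟨ factor q (g a n m) R s ⟩
  q * g a n m * (R ℚ.+ s)                    ≡⟨ cong₂ _*_ (g-suc m n≤a) (∑-last (summand a n n≤a) m) ⟨
  p * g a n (suc m) * R₊                     ≡⟨ ℚ.*-assoc p (g a n (suc m)) R₊ ⟩
  p * (g a n (suc m) * R₊)                   ∎)
  where
  p q s R R₊ : ℚ
  p = fromℕ (P a m)
  q = fromℕ (Q a n m)
  s = summand a n n≤a m
  R = ∑[ i < m ] summand a n n≤a (toℕ i)
  R₊ = ∑[ i < suc m ] summand a n n≤a (toℕ i)
  m≤n : m ≤ n
  m≤n = ℕ.m<1+n⇒m≤n (≤-trans m<n+1 (ℕ.≤-reflexive (ℕ.+-comm n 1)))
  P-nonZero : NonZero (P a m)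
  P-nonZero = ℕ.m*n≢0 (suc m) (a + m + 4) {{_}} {{+suc-nonZero (a + m) 3}}
  factor : ∀ q h r s → q * (h * r) ℚ.+ q * h * s ≡ q * h * (r ℚ.+ s)
  factor = solve 4 (λ q h r s → q :* (h :* r) :+ q :* h :* s := q :* h :* (r :+ s)) refl
    where open +-*-Solver

theorem3 : (m n a : ℕ) → 1 ≤ m → m ≤ n + 1 → (n≤a : n ≤ a) →
    (∑[ k < m ] (binom⁻¹ m (toℕ k) (toℕ≤n k) * binom⁻¹ a (n ∸ toℕ k) (≤-trans (m∸n≤m n (toℕ k)) n≤a)))
    ≡ g a n m * (∑[ i < m ] summand a n n≤a (toℕ i))
theorem3 m n a _ m≤n+1 n≤a = trans
  (sum-cong-≗ {m} (λ k → cong₂ _*_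
    (binom⁻¹≡β m (toℕ k) (toℕ≤n k))
    (binom⁻¹≡β a (n ∸ toℕ k) (≤-trans (m∸n≤m n (toℕ k)) n≤a))))
  (S-closed m m≤n+1 n≤a)
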